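{- Let $\lambda$ be a nonzero real number and $n$ a positive integer. Then, as polynomials in $x$, $$F_{n+1,\lambda}(x)=(x-n\lambda)F_{n,\lambda}(x)+(x+x^{2})F_{n,\lambda}'(x),$$ where $F_{n,\lambda}'(x)=\frac{d}{dx}F_{n,\lambda}(x)$.
   Context: For real $y$ and integer $k\ge0$: $(y)_{0,\lambda}=1$, $(y)_{k,\lambda}=y(y-\lambda)\cdots(y-(k-1)\lambda)$. The degenerate exponential is $e_\lambda(t)=\sum_{k\ge0}(1)_{k,\lambda}t^k/k!=(1+\lambda t)^{1/\lambda}$. The degenerate Fubini polynomials are defined by $\frac{1}{1-x(e_\lambda(t)-1)}=\sum_{n\ge0}F_{n,\lambda}(x)\frac{t^n}{n!}$. -}

module Defs where

open import Level using (Level; 0ℓ; _⊔_)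
open import Algebra.Bundles using (CommutativeRing)
open import Data.Fin.Base using (Fin; zero; suc; toℕ)
open import Data.Integer.Base using (+_)
open import Data.Nat.Base as ℕ using (ℕ; zero; suc; _∸_; _!)
import Data.Nat.Properties as ℕ
open import Data.Product.Base using (∃; _×_; _,_; proj₁; proj₂)
open import Data.Rational.Base as ℚ using (ℚ; 0ℚ; 1ℚ; ½; ∣_∣)
import Data.Rational.Properties as ℚ
open import Data.Rational.Unnormalised.Base using (mkℚᵘ)
import Data.Rational.Unnormalised.Properties as ℚᵘ
open import Data.Rational.Solver using (module +-*-Solver)
open import Data.Sum.Base using (inj₁; inj₂)
open import Data.Vec.Functional using (Vector; _∷_; replicate)
open import Relation.Binary.Structures using (IsEquivalence)
open import Relation.Binary.PropositionalEquality as ≡ using (_≡_; refl; cong; subst)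
import Algebra.Definitions.RawMonoid as RawMonoidOperations
import Algebra.Properties.CommutativeSemigroup as CommutativeSemigroupProperties
import Algebra.Properties.Ring as RingProperties
import Algebra.Properties.Semiring.Sum as SemiringSum
import Relation.Binary.Reasoning.Setoid as SetoidReasoning

-- The reals as Cauchy sequences of rationals modulo null sequences; ∃ is Σ,
-- so every Cauchy or null sequence carries a modulus.

record ℝ : Set where
  no-eta-equality
  field
    seq    : ℕ → ℚ
    cauchy : ∀ ε → 0ℚ ℚ.< ε → ∃ λ N → ∀ m n → N ℕ.≤ m → N ℕ.≤ n → ∣ seq m ℚ.- seq n ∣ ℚ.< ε

open ℝ

infix 4 _≃_

record _≃_ (x y : ℝ) : Set where
  constructor mk≃
  field
    null : ∀ ε → 0ℚ ℚ.< ε → ∃ λ N → ∀ n → N ℕ.≤ n → ∣ seq x n ℚ.- seq y n ∣ ℚ.< ε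

open _≃_

private
  module _ where
    open ℚ.≤-Reasoning
    open +-*-Solver

    ½ε+½ε≡ε : ∀ ε → ½ ℚ.* ε ℚ.+ ½ ℚ.* ε ≡ ε
    ½ε+½ε≡ε ε = ≡.trans (≡.sym (ℚ.*-distribʳ-+ ε ½ ½)) (ℚ.*-identityˡ ε)

    0<½ε : ∀ {ε} → 0ℚ ℚ.< ε → 0ℚ ℚ.< ½ ℚ.* ε
    0<½ε {ε} 0<ε = subst (ℚ._< ½ ℚ.* ε) (ℚ.*-zeroʳ ½) (ℚ.*-monoʳ-<-pos ½ 0<ε)

    ∣p-p∣<ε : ∀ p {ε} → 0ℚ ℚ.< ε → ∣ p ℚ.- p ∣ ℚ.< ε
    ∣p-p∣<ε p {ε} 0<ε = subst (λ d → ∣ d ∣ ℚ.< ε) (≡.sym (ℚ.+-inverseʳ p)) 0<ε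

    ∣p-q∣≡∣q-p∣ : ∀ p q → ∣ p ℚ.- q ∣ ≡ ∣ q ℚ.- p ∣
    ∣p-q∣≡∣q-p∣ p q = ≡.trans
      (cong ∣_∣ (solve 2 (λ p q → p :- q := :- (q :- p)) refl p q))
      (ℚ.∣-p∣≡∣p∣ (q ℚ.- p))

    +-close : ∀ {p q d} a b {ε} → d ≡ a ℚ.+ b → ∣ a ∣ ℚ.≤ p → ∣ b ∣ ℚ.< q → p ℚ.+ q ≡ ε → ∣ d ∣ ℚ.< ε
    +-close {p} {q} {d} a b {ε} d≡ a≤ b< pq = begin-strict
      ∣ d ∣             ≡⟨ cong ∣_∣ d≡ ⟩
      ∣ a ℚ.+ b ∣       ≤⟨ ℚ.∣p+q∣≤∣p∣+∣q∣ a b ⟩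
      ∣ a ∣ ℚ.+ ∣ b ∣   <⟨ ℚ.+-mono-≤-< a≤ b< ⟩
      p ℚ.+ q           ≡⟨ pq ⟩
      ε                 ∎

    half-close : ∀ d a b {ε} → d ≡ a ℚ.+ b → ∣ a ∣ ℚ.< ½ ℚ.* ε → ∣ b ∣ ℚ.< ½ ℚ.* ε → ∣ d ∣ ℚ.< ε
    half-close d a b {ε} d≡ a< b< = +-close a b d≡ (ℚ.<⇒≤ a<) b< (½ε+½ε≡ε ε)

    *-small : ∀ {A δ} a b → 0ℚ ℚ.< A → ∣ a ∣ ℚ.≤ A → ∣ b ∣ ℚ.< δ → ∣ a ℚ.* b ∣ ℚ.< A ℚ.* δ
    *-small {A} {δ} a b 0<A a≤A b<δ = begin-strict
      ∣ a ℚ.* b ∣       ≡⟨ ℚ.∣p*q∣≡∣p∣*∣q∣ a b ⟩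
      ∣ a ∣ ℚ.* ∣ b ∣   ≤⟨ ℚ.*-monoʳ-≤-nonNeg ∣ b ∣ {{ℚ.nonNegative (ℚ.0≤∣p∣ b)}} a≤A ⟩
      A ℚ.* ∣ b ∣       <⟨ ℚ.*-monoʳ-<-pos A {{ℚ.positive 0<A}} b<δ ⟩
      A ℚ.* δ           ∎

    *-close : ∀ {A D δ ε} a b c d → 0ℚ ℚ.< A → 0ℚ ℚ.< D → ∣ a ∣ ℚ.≤ A → ∣ d ∣ ℚ.≤ D →
              ∣ a ℚ.- c ∣ ℚ.< δ → ∣ b ℚ.- d ∣ ℚ.< δ → (A ℚ.+ D) ℚ.* δ ≡ ε →
              ∣ a ℚ.* b ℚ.- c ℚ.* d ∣ ℚ.< ε
    *-close {A} {D} {δ} a b c d 0<A 0<D a≤A d≤D ac bd eq =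
      +-close (a ℚ.* (b ℚ.- d)) (d ℚ.* (a ℚ.- c))
        (solve 4 (λ a b c d → a :* b :- c :* d := a :* (b :- d) :+ d :* (a :- c)) refl a b c d)
        (ℚ.<⇒≤ (*-small a (b ℚ.- d) 0<A a≤A bd))
        (*-small d (a ℚ.- c) 0<D d≤D ac)
        (≡.trans (≡.sym (ℚ.*-distribʳ-+ δ A D)) eq)

    quotient : ∀ {K ε} → 0ℚ ℚ.< K → 0ℚ ℚ.< ε → ∃ λ δ → 0ℚ ℚ.< δ × K ℚ.* δ ≡ ε
    quotient {K} {ε} 0<K 0<ε = δ , 0<δ , Kδ≡ε
      where
      instance
        K-pos = ℚ.positive 0<K
        K-nonZero = ℚ.pos⇒nonZero K
        1/K-pos = ℚ.1/pos⇒pos K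
      δ = ℚ.1/ K ℚ.* ε
      0<δ = subst (ℚ._< δ) (ℚ.*-zeroʳ (ℚ.1/ K)) (ℚ.*-monoʳ-<-pos (ℚ.1/ K) 0<ε)
      Kδ≡ε = ≡.trans (≡.sym (ℚ.*-assoc K (ℚ.1/ K) ε))
               (≡.trans (cong (ℚ._* ε) (ℚ.*-inverseʳ K)) (ℚ.*-identityˡ ε))

    p≤p+q : ∀ {p q} → 0ℚ ℚ.≤ q → p ℚ.≤ p ℚ.+ q
    p≤p+q {p} {q} 0≤q = subst (ℚ._≤ p ℚ.+ q) (ℚ.+-identityʳ p) (ℚ.+-monoʳ-≤ p 0≤q)

    q≤p+q : ∀ {p q} → 0ℚ ℚ.≤ p → q ℚ.≤ p ℚ.+ q
    q≤p+q {p} {q} 0≤p = subst (q ℚ.≤_) (ℚ.+-comm q p) (p≤p+q 0≤p)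

    0≤1 : 0ℚ ℚ.≤ 1ℚ
    0≤1 = ℚ.nonNegative⁻¹ 1ℚ

    module _ (f : ℕ → ℚ) where
      total : ℕ → ℚ
      total zero    = 0ℚ
      total (suc n) = total n ℚ.+ ∣ f n ∣

      0≤total : ∀ n → 0ℚ ℚ.≤ total n
      0≤total zero    = ℚ.≤-refl
      0≤total (suc n) = ℚ.≤-trans (0≤total n) (p≤p+q (ℚ.0≤∣p∣ (f n)))

      ∣f∣≤total : ∀ {m} n → m ℕ.≤ n → ∣ f m ∣ ℚ.≤ total (suc n)
      ∣f∣≤total zero    ℕ.z≤n = q≤p+q ℚ.≤-refl
      ∣f∣≤total (suc n) m≤1+n with ℕ.m≤n⇒m<n∨m≡n m≤1+n
      ... | inj₁ (ℕ.s≤s m≤n) = ℚ.≤-trans (∣f∣≤total n m≤n) (p≤p+q (ℚ.0≤∣p∣ (f (suc n))))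
      ... | inj₂ refl        = q≤p+q (0≤total (suc n))

    bounded : ∀ x → ∃ λ B → 0ℚ ℚ.< B × (∀ n → ∣ seq x n ∣ ℚ.≤ B)
    bounded x with cauchy x 1ℚ (ℚ.positive⁻¹ 1ℚ)
    ... | N , close = B , 0<B , bound
      where
      T = total (seq x) (suc N)
      B = T ℚ.+ 1ℚ
      0<B = ℚ.<-≤-trans (ℚ.positive⁻¹ 1ℚ) (q≤p+q (0≤total (seq x) (suc N)))
      bound : ∀ n → ∣ seq x n ∣ ℚ.≤ B
      bound n with ℕ.≤-total n N
      ... | inj₁ n≤N = ℚ.≤-trans (∣f∣≤total (seq x) N n≤N) (p≤p+q 0≤1)
      ... | inj₂ N≤n = ℚ.<⇒≤ (+-close (seq x N) (seq x n ℚ.- seq x N)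
              (solve 2 (λ p q → p := q :+ (p :- q)) refl (seq x n) (seq x N))
              (∣f∣≤total (seq x) N ℕ.≤-refl) (close n N N≤n ℕ.≤-refl) refl)

    ≤⊔ˡ : ∀ {m n k} → m ℕ.⊔ n ℕ.≤ k → m ℕ.≤ k
    ≤⊔ˡ {m} {n} = ℕ.≤-trans (ℕ.m≤m⊔n m n)

    ≤⊔ʳ : ∀ {m n k} → m ℕ.⊔ n ℕ.≤ k → n ℕ.≤ k
    ≤⊔ʳ {m} {n} = ℕ.≤-trans (ℕ.m≤n⊔m m n)

≗⇒≃ : ∀ {x y} → (∀ n → seq x n ≡ seq y n) → x ≃ y
≗⇒≃ {x} {y} eq .null ε 0<ε = 0 , λ n _ →
  subst (λ q → ∣ seq x n ℚ.- q ∣ ℚ.< ε) (eq n) (∣p-p∣<ε (seq x n) 0<ε)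

fromℚ : ℚ → ℝ
fromℚ q .seq _ = q
fromℚ q .cauchy ε 0<ε = 0 , λ _ _ _ _ → ∣p-p∣<ε q 0<ε

fromℕ : ℕ → ℝ
fromℕ n = fromℚ (+ n ℚ./ 1)

0ℝ 1ℝ : ℝ
0ℝ = fromℚ 0ℚ
1ℝ = fromℚ 1ℚ

infix  8 -ℝ_
infixl 7 _*ℝ_
infixl 6 _+ℝ_ _-ℝ_

_+ℝ_ : ℝ → ℝ → ℝ
(x +ℝ y) .seq n = seq x n ℚ.+ seq y n
(x +ℝ y) .cauchy ε 0<ε with cauchy x _ (0<½ε 0<ε) | cauchy y _ (0<½ε 0<ε)
... | M , p | N , q = M ℕ.⊔ N , λ m n m≥ n≥ → half-close _ _ _
  (let open +-*-Solver in solve 4 (λ a b c d → (a :+ b) :- (c :+ d) := (a :- c) :+ (b :- d)) refl (seq x m) (seq y m) (seq x n) (seq y n))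
  (p m n (≤⊔ˡ m≥) (≤⊔ˡ n≥)) (q m n (≤⊔ʳ m≥) (≤⊔ʳ n≥))

-ℝ_ : ℝ → ℝ
(-ℝ x) .seq n = ℚ.- seq x n
(-ℝ x) .cauchy ε 0<ε with cauchy x ε 0<ε
... | N , p = N , λ m n m≥ n≥ → subst (λ d → ∣ d ∣ ℚ.< ε)
  (let open +-*-Solver in solve 2 (λ a b → b :- a := (:- a) :- (:- b)) refl (seq x m) (seq x n))
  (p n m n≥ m≥)

_-ℝ_ : ℝ → ℝ → ℝ
x -ℝ y = x +ℝ (-ℝ y)

_*ℝ_ : ℝ → ℝ → ℝ
(x *ℝ y) .seq n = seq x n ℚ.* seq y n
(x *ℝ y) .cauchy ε 0<ε with bounded x | bounded y
... | A , 0<A , x≤A | D , 0<D , y≤D with quotient (ℚ.+-mono-< 0<A 0<D) 0<ε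
... | δ , 0<δ , eq with cauchy x δ 0<δ | cauchy y δ 0<δ
... | M , p | N , q = M ℕ.⊔ N , λ m n m≥ n≥ →
  *-close (seq x m) (seq y m) (seq x n) (seq y n) 0<A 0<D (x≤A m) (y≤D n)
    (p m n (≤⊔ˡ m≥) (≤⊔ˡ n≥)) (q m n (≤⊔ʳ m≥) (≤⊔ʳ n≥)) eq

private
  ≃-isEquivalence : IsEquivalence _≃_
  ≃-isEquivalence = record
    { refl  = ≗⇒≃ λ _ → refl
    ; sym   = λ {x} {y} x≃y → mk≃ λ ε 0<ε → let (N , p) = null x≃y ε 0<ε in
                N , λ n n≥ → subst (ℚ._< ε) (∣p-q∣≡∣q-p∣ (seq x n) (seq y n)) (p n n≥)
    ; trans = λ {x} {y} {z} x≃y y≃z → mk≃ λ ε 0<ε →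
                let (M , p) = null x≃y _ (0<½ε 0<ε)
                    (N , q) = null y≃z _ (0<½ε 0<ε)
                    open +-*-Solver
                in M ℕ.⊔ N , λ n n≥ → half-close _ _ _
                     (solve 3 (λ a b c → a :- c := (a :- b) :+ (b :- c)) refl (seq x n) (seq y n) (seq z n))
                     (p n (≤⊔ˡ n≥)) (q n (≤⊔ʳ n≥))
    }

  +ℝ-cong : ∀ {x y u v} → x ≃ y → u ≃ v → x +ℝ u ≃ y +ℝ v
  +ℝ-cong {x} {y} {u} {v} x≃y u≃v .null ε 0<ε with null x≃y _ (0<½ε 0<ε) | null u≃v _ (0<½ε 0<ε)
  ... | M , p | N , q = M ℕ.⊔ N , λ n n≥ → half-close _ _ _
    (let open +-*-Solver in solve 4 (λ a b c d → (a :+ b) :- (c :+ d) := (a :- c) :+ (b :- d)) refl (seq x n) (seq u n) (seq y n) (seq v n))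
    (p n (≤⊔ˡ n≥)) (q n (≤⊔ʳ n≥))

  -ℝ-cong : ∀ {x y} → x ≃ y → -ℝ x ≃ -ℝ y
  -ℝ-cong {x} {y} x≃y .null ε 0<ε with null x≃y ε 0<ε
  ... | N , p = N , λ n n≥ → subst (ℚ._< ε)
    (≡.trans (∣p-q∣≡∣q-p∣ (seq x n) (seq y n))
      (cong ∣_∣ (let open +-*-Solver in solve 2 (λ a b → b :- a := (:- a) :- (:- b)) refl (seq x n) (seq y n))))
    (p n n≥)

  *ℝ-cong : ∀ {x y u v} → x ≃ y → u ≃ v → x *ℝ u ≃ y *ℝ v
  *ℝ-cong {x} {y} {u} {v} x≃y u≃v .null ε 0<ε with bounded x | bounded v
  ... | A , 0<A , x≤A | D , 0<D , v≤D with quotient (ℚ.+-mono-< 0<A 0<D) 0<ε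
  ... | δ , 0<δ , eq with null x≃y δ 0<δ | null u≃v δ 0<δ
  ... | M , p | N , q = M ℕ.⊔ N , λ n n≥ →
    *-close (seq x n) (seq u n) (seq y n) (seq v n) 0<A 0<D (x≤A n) (v≤D n)
      (p n (≤⊔ˡ n≥)) (q n (≤⊔ʳ n≥)) eq

ℝ-commutativeRing : CommutativeRing 0ℓ 0ℓ
ℝ-commutativeRing = record
  { Carrier = ℝ ; _≈_ = _≃_ ; _+_ = _+ℝ_ ; _*_ = _*ℝ_ ; -_ = -ℝ_ ; 0# = 0ℝ ; 1# = 1ℝ
  ; isCommutativeRing = record
    { isRing = record
      { +-isAbelianGroup = record
        { isGroup = record
          { isMonoid = record
            { isSemigroup = record
              { isMagma = record { isEquivalence = ≃-isEquivalence ; ∙-cong = +ℝ-cong }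
              ; assoc   = λ x y z → ≗⇒≃ λ n → ℚ.+-assoc (seq x n) (seq y n) (seq z n)
              }
            ; identity = (λ x → ≗⇒≃ λ n → ℚ.+-identityˡ (seq x n))
                       , (λ x → ≗⇒≃ λ n → ℚ.+-identityʳ (seq x n))
            }
          ; inverse = (λ x → ≗⇒≃ λ n → ℚ.+-inverseˡ (seq x n))
                    , (λ x → ≗⇒≃ λ n → ℚ.+-inverseʳ (seq x n))
          ; ⁻¹-cong = -ℝ-cong
          }
        ; comm = λ x y → ≗⇒≃ λ n → ℚ.+-comm (seq x n) (seq y n)
        }
      ; *-cong = *ℝ-cong
      ; *-assoc = λ x y z → ≗⇒≃ λ n → ℚ.*-assoc (seq x n) (seq y n) (seq z n)
      ; *-identity = (λ x → ≗⇒≃ λ n → ℚ.*-identityˡ (seq x n))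
                   , (λ x → ≗⇒≃ λ n → ℚ.*-identityʳ (seq x n))
      ; distrib = (λ x y z → ≗⇒≃ λ n → ℚ.*-distribˡ-+ (seq x n) (seq y n) (seq z n))
                , (λ x y z → ≗⇒≃ λ n → ℚ.*-distribʳ-+ (seq x n) (seq y n) (seq z n))
      }
    ; *-comm = λ x y → ≗⇒≃ λ n → ℚ.*-comm (seq x n) (seq y n)
    }
  }

module Convolution {c ℓ : Level} (R : CommutativeRing c ℓ) where

  open CommutativeRing R renaming (refl to ≈-refl; sym to ≈-sym; trans to ≈-trans)
  open SemiringSum semiring using (sum-syntax; sum⁺-syntax; sum-cong-≋; sum-replicate-zero; ∑-distrib-+; *-distribˡ-sum)
  open CommutativeSemigroupProperties +-commutativeSemigroup using (x∙yz≈y∙xz)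
  open SetoidReasoning setoid

  conv : (ℕ → Carrier) → (ℕ → Carrier) → ℕ → Carrier
  conv a b n = ∑[ i ≤ n ] (a (toℕ i) * b (n ∸ toℕ i))

  constant : Carrier → ℕ → Carrier
  constant r zero    = r
  constant r (suc _) = 0#

  conv-cong : ∀ {a a′ b b′} → (∀ n → a n ≈ a′ n) → (∀ n → b n ≈ b′ n) → ∀ n → conv a b n ≈ conv a′ b′ n
  conv-cong p q n = sum-cong-≋ {n = suc n} λ i → *-cong (p (toℕ i)) (q (n ∸ toℕ i))

  conv-distribʳ : ∀ c a b n → conv (λ k → a k + b k) c n ≈ conv a c n + conv b c n
  conv-distribʳ c a b n = ≈-trans
    (sum-cong-≋ {n = suc n} λ i → distribʳ (c (n ∸ toℕ i)) (a (toℕ i)) (b (toℕ i)))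
    (∑-distrib-+ {suc n} (λ i → a (toℕ i) * c (n ∸ toℕ i)) (λ i → b (toℕ i) * c (n ∸ toℕ i)))

  conv-scale : ∀ r a b n → conv (λ k → r * a k) b n ≈ r * conv a b n
  conv-scale r a b n = ≈-trans
    (sum-cong-≋ {n = suc n} λ i → *-assoc r (a (toℕ i)) (b (n ∸ toℕ i)))
    (≈-sym (*-distribˡ-sum {suc n} r (λ i → a (toℕ i) * b (n ∸ toℕ i))))

  conv-zero : ∀ a b n → (∀ (i : Fin (suc n)) → a (toℕ i) * b (n ∸ toℕ i) ≈ 0#) → conv a b n ≈ 0#
  conv-zero a b n p = ≈-trans (sum-cong-≋ {n = suc n} {x = λ i → a (toℕ i) * b (n ∸ toℕ i)} {y = replicate (suc n) 0#} p)
    (sum-replicate-zero (suc n))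

  conv-last : ∀ a b n → conv a b (suc n) ≈ a (suc n) * b 0 + conv a (λ k → b (suc k)) n
  conv-last a b zero    = x∙yz≈y∙xz (a 0 * b 1) (a 1 * b 0) 0#
  conv-last a b (suc n) = ≈-trans
    (+-congˡ (conv-last (λ k → a (suc k)) b n))
    (x∙yz≈y∙xz (a 0 * b (suc (suc n))) _ _)

  conv-comm : ∀ a b n → conv a b n ≈ conv b a n
  conv-comm a b zero    = +-congʳ (*-comm (a 0) (b 0))
  conv-comm a b (suc n) = ≈-trans
    (+-cong (*-comm (a 0) (b (suc n))) (conv-comm (λ k → a (suc k)) b n))
    (≈-sym (conv-last b a n))

  conv-assoc : ∀ a b c n → conv (conv a b) c n ≈ conv a (conv b c) n
  conv-assoc a b c zero = +-congʳ (begin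
    (a 0 * b 0 + 0#) * c 0   ≈⟨ *-congʳ (+-identityʳ _) ⟩
    a 0 * b 0 * c 0          ≈⟨ *-assoc _ _ _ ⟩
    a 0 * (b 0 * c 0)        ≈⟨ *-congˡ (+-identityʳ _) ⟨
    a 0 * (b 0 * c 0 + 0#)   ∎)
  conv-assoc a b c (suc n) = begin
    (a 0 * b 0 + 0#) * c (suc n) + conv (λ k → a 0 * b (suc k) + conv a′ b k) c n
      ≈⟨ +-cong (≈-trans (*-congʳ (+-identityʳ _)) (*-assoc _ _ _)) (conv-distribʳ c (λ k → a 0 * b (suc k)) (conv a′ b) n) ⟩
    a 0 * (b 0 * c (suc n)) + (conv (λ k → a 0 * b (suc k)) c n + conv (conv a′ b) c n)
      ≈⟨ +-congˡ (+-cong (conv-scale (a 0) (λ k → b (suc k)) c n) (conv-assoc a′ b c n)) ⟩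
    a 0 * (b 0 * c (suc n)) + (a 0 * conv (λ k → b (suc k)) c n + conv a′ (conv b c) n)
      ≈⟨ +-assoc _ _ _ ⟨
    (a 0 * (b 0 * c (suc n)) + a 0 * conv (λ k → b (suc k)) c n) + conv a′ (conv b c) n
      ≈⟨ +-congʳ (distribˡ _ _ _) ⟨
    a 0 * conv b c (suc n) + conv a′ (conv b c) n ∎
    where
    a′ : ℕ → Carrier
    a′ k = a (suc k)

  conv-constant : ∀ r a n → conv (constant r) a n ≈ r * a n
  conv-constant r a zero    = +-identityʳ _
  conv-constant r a (suc n) = ≈-trans (+-congˡ (conv-zero (λ k → constant r (suc k)) a n λ i → zeroˡ _)) (+-identityʳ _)

  conv-identityˡ : ∀ a n → conv (constant 1#) a n ≈ a n
  conv-identityˡ a n = ≈-trans (conv-constant 1# a n) (*-identityˡ _)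

  conv-distribˡ : ∀ a b c n → conv a (λ k → b k + c k) n ≈ conv a b n + conv a c n
  conv-distribˡ a b c n = ≈-trans (conv-comm a (λ k → b k + c k) n) (≈-trans (conv-distribʳ a b c n)
    (+-cong (conv-comm b a n) (conv-comm c a n)))

  conv-identityʳ : ∀ a n → conv a (constant 1#) n ≈ a n
  conv-identityʳ a n = ≈-trans (conv-comm a (constant 1#) n) (conv-identityˡ a n)

module PowerSeries {c ℓ : Level} (R : CommutativeRing c ℓ) where

  private
    module R = CommutativeRing R
  open R using (Carrier)
  open Convolution R
  open SemiringSum R.semiring using (sum-syntax; sum⁺-syntax; sum-cong-≋)

  record Series : Set c where
    no-eta-equality
    constructor series
    field
      coeff : ℕ → Carrier

  open Series public

  infix  8 -_
  infixl 7 _*_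
  infixl 6 _+_ _-_
  infix  4 _≈_

  record _≈_ (f g : Series) : Set ℓ where
    constructor mk≈
    field
      at : ∀ n → coeff f n R.≈ coeff g n

  open _≈_ public

  0# 1# : Series
  0# .coeff _ = R.0#
  1# .coeff   = constant R.1#

  _+_ _*_ : Series → Series → Series
  (f + g) .coeff n = coeff f n R.+ coeff g n
  (f * g) .coeff   = conv (coeff f) (coeff g)

  -_ : Series → Series
  (- f) .coeff n = R.- coeff f n

  _-_ : Series → Series → Series
  f - g = f + (- g)

  commutativeRing : CommutativeRing c ℓ
  commutativeRing = record
    { Carrier = Series ; _≈_ = _≈_ ; _+_ = _+_ ; _*_ = _*_ ; -_ = -_ ; 0# = 0# ; 1# = 1#
    ; isCommutativeRing = record
      { isRing = record
        { +-isAbelianGroup = record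
          { isGroup = record
            { isMonoid = record
              { isSemigroup = record
                { isMagma = record
                  { isEquivalence = record
                    { refl  = mk≈ λ _ → R.refl
                    ; sym   = λ p → mk≈ λ n → R.sym (at p n)
                    ; trans = λ p q → mk≈ λ n → R.trans (at p n) (at q n)
                    }
                  ; ∙-cong = λ p q → mk≈ λ n → R.+-cong (at p n) (at q n)
                  }
                ; assoc = λ f g h → mk≈ λ n → R.+-assoc _ _ _
                }
              ; identity = (λ f → mk≈ λ n → R.+-identityˡ _) , (λ f → mk≈ λ n → R.+-identityʳ _)
              }
            ; inverse = (λ f → mk≈ λ n → R.-‿inverseˡ _) , (λ f → mk≈ λ n → R.-‿inverseʳ _)
            ; ⁻¹-cong = λ p → mk≈ λ n → R.-‿cong (at p n)
            }
          ; comm = λ f g → mk≈ λ n → R.+-comm _ _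
          }
        ; *-cong = λ p q → mk≈ (conv-cong (at p) (at q))
        ; *-assoc = λ f g h → mk≈ (conv-assoc (coeff f) (coeff g) (coeff h))
        ; *-identity = (λ f → mk≈ (conv-identityˡ (coeff f))) , (λ f → mk≈ (conv-identityʳ (coeff f)))
        ; distrib = (λ f g h → mk≈ (conv-distribˡ (coeff f) (coeff g) (coeff h)))
                  , (λ f g h → mk≈ (conv-distribʳ (coeff f) (coeff g) (coeff h)))
        }
      ; *-comm = λ f g → mk≈ (conv-comm (coeff f) (coeff g))
      }
    }

  C : Carrier → Series
  C r .coeff = constant r

  -- The coefficients g₀, …, gₙ of 1/f, in the order gₙ, …, g₀, for f with
  -- constant term 1:  g₀ = 1 and gₙ₊₁ = - (f₁ gₙ + f₂ gₙ₋₁ + ⋯ + fₙ₊₁ g₀).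
  recipPrefix : Series → (n : ℕ) → Vector Carrier (suc n)
  recipPrefix f zero    = replicate 1 R.1#
  recipPrefix f (suc n) =
    (R.- (∑[ i ≤ n ] (coeff f (suc (toℕ i)) R.* recipPrefix f n i))) ∷ recipPrefix f n

  recip : (f : Series) → coeff f 0 R.≈ R.1# → Series
  recip f _ .coeff n = recipPrefix f n zero

  recip-inverseʳ : ∀ f (f₀≈1 : coeff f 0 R.≈ R.1#) → f * recip f f₀≈1 ≈ 1#
  recip-inverseʳ f f₀≈1 .at zero    =
    R.trans (R.+-identityʳ _) (R.trans (R.*-identityʳ _) f₀≈1)
  recip-inverseʳ f f₀≈1 .at (suc n) = R.trans
    (R.+-cong (R.trans (R.*-congʳ f₀≈1) (R.*-identityˡ _))
      (sum-cong-≋ {n = suc n} λ i → R.*-congˡ {coeff f (suc (toℕ i))} (R.reflexive (≡.sym (prefix n i)))))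
    (R.-‿inverseˡ _)
    where
    prefix : ∀ n (i : Fin (suc n)) → recipPrefix f n i ≡ recipPrefix f (n ∸ toℕ i) zero
    prefix n       zero    = refl
    prefix (suc n) (suc i) = prefix n i

module Polynomial {c ℓ : Level} (R : CommutativeRing c ℓ) where

  private
    module R = CommutativeRing R
    module R-Props = RingProperties R.ring
  open R using (Carrier)
  open Convolution R
  open RawMonoidOperations R.+-rawMonoid using () renaming (_×_ to _·_)

  record Poly : Set (c ⊔ ℓ) where
    no-eta-equality
    field
      coeff  : ℕ → Carrier
      finite : ∃ λ N → ∀ k → N ℕ.≤ k → coeff k R.≈ R.0#

  open Poly public

  infix  8 -_
  infixl 7 _*_
  infixl 6 _+_ _-_
  infix  4 _≈_

  record _≈_ (p q : Poly) : Set ℓ where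
    constructor mk≈
    field
      at : ∀ k → coeff p k R.≈ coeff q k

  open _≈_ public

  C : Carrier → Poly
  C r .coeff  = constant r
  C r .finite = 1 , λ { (suc k) _ → R.refl }

  X : Poly
  X .coeff zero    = R.0#
  X .coeff (suc k) = constant R.1# k
  X .finite = 2 , λ { (suc (suc k)) _ → R.refl ; (suc zero) (ℕ.s≤s ()) }

  0# 1# : Poly
  0# .coeff _ = R.0#
  0# .finite  = 0 , λ _ _ → R.refl
  1# = C R.1#

  _+_ _*_ : Poly → Poly → Poly

  (p + q) .coeff k = coeff p k R.+ coeff q k
  (p + q) .finite with finite p | finite q
  ... | M , u | N , v = M ℕ.⊔ N , λ k k≥ →
    R.trans (R.+-cong (u k (≤⊔ˡ k≥)) (v k (≤⊔ʳ k≥))) (R.+-identityʳ R.0#)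

  (p * q) .coeff = conv (coeff p) (coeff q)
  (p * q) .finite with finite p | finite q
  ... | M , u | N , v = M ℕ.+ N , λ k k≥ → conv-zero (coeff p) (coeff q) k (λ i → vanish k k≥ (toℕ i))
    where
    vanish : ∀ k → M ℕ.+ N ℕ.≤ k → ∀ i → coeff p i R.* coeff q (k ∸ i) R.≈ R.0#
    vanish k k≥ i with ℕ.≤-total M i
    ... | inj₁ M≤i = R.trans (R.*-congʳ (u i M≤i)) (R.zeroˡ _)
    ... | inj₂ i≤M = R.trans (R.*-congˡ (v (k ∸ i) (ℕ.≤-trans
      (ℕ.m+n≤o⇒m≤o∸n N (subst (ℕ._≤ k) (ℕ.+-comm M N) k≥)) (ℕ.∸-monoʳ-≤ k i≤M)))) (R.zeroʳ _)

  -_ : Poly → Poly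
  (- p) .coeff k = R.- coeff p k
  (- p) .finite with finite p
  ... | N , u = N , λ k k≥ → R.trans (R.-‿cong (u k k≥)) R-Props.-0#≈0#

  _-_ : Poly → Poly → Poly
  p - q = p + (- q)

  ∂ : Poly → Poly
  ∂ p .coeff k = suc k · coeff p (suc k)
  ∂ p .finite with finite p
  ... | N , u = N , λ k k≥ → multiple (suc k) (u (suc k) (ℕ.m≤n⇒m≤1+n k≥))
    where
    multiple : ∀ n {r} → r R.≈ R.0# → n · r R.≈ R.0#
    multiple zero    _   = R.refl
    multiple (suc n) r≈0 = R.trans (R.+-cong r≈0 (multiple n r≈0)) (R.+-identityʳ R.0#)

  commutativeRing : CommutativeRing (c ⊔ ℓ) ℓ
  commutativeRing = record
    { Carrier = Poly ; _≈_ = _≈_ ; _+_ = _+_ ; _*_ = _*_ ; -_ = -_ ; 0# = 0# ; 1# = 1#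
    ; isCommutativeRing = record
      { isRing = record
        { +-isAbelianGroup = record
          { isGroup = record
            { isMonoid = record
              { isSemigroup = record
                { isMagma = record
                  { isEquivalence = record
                    { refl  = mk≈ λ _ → R.refl
                    ; sym   = λ p → mk≈ λ n → R.sym (at p n)
                    ; trans = λ p q → mk≈ λ n → R.trans (at p n) (at q n)
                    }
                  ; ∙-cong = λ p q → mk≈ λ n → R.+-cong (at p n) (at q n)
                  }
                ; assoc = λ f g h → mk≈ λ n → R.+-assoc _ _ _
                }
              ; identity = (λ f → mk≈ λ n → R.+-identityˡ _) , (λ f → mk≈ λ n → R.+-identityʳ _)
              }
            ; inverse = (λ f → mk≈ λ n → R.-‿inverseˡ _) , (λ f → mk≈ λ n → R.-‿inverseʳ _)
            ; ⁻¹-cong = λ p → mk≈ λ n → R.-‿cong (at p n)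
            }
          ; comm = λ f g → mk≈ λ n → R.+-comm _ _
          }
        ; *-cong = λ p q → mk≈ (conv-cong (at p) (at q))
        ; *-assoc = λ f g h → mk≈ (conv-assoc (coeff f) (coeff g) (coeff h))
        ; *-identity = (λ f → mk≈ (conv-identityˡ (coeff f))) , (λ f → mk≈ (conv-identityʳ (coeff f)))
        ; distrib = (λ f g h → mk≈ (conv-distribˡ (coeff f) (coeff g) (coeff h)))
                  , (λ f g h → mk≈ (conv-distribʳ (coeff f) (coeff g) (coeff h)))
        }
      ; *-comm = λ f g → mk≈ (conv-comm (coeff f) (coeff g))
      }
    }

module ℝ[x] = Polynomial ℝ-commutativeRing
module ℝ[x]⟦t⟧ = PowerSeries ℝ[x].commutativeRing

-- (y)_{k,λ} = y (y - λ) ⋯ (y - (k - 1) λ)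
fallingFactorial : ℝ → ℝ → ℕ → ℝ
fallingFactorial lam y zero    = 1ℝ
fallingFactorial lam y (suc k) = fallingFactorial lam y k *ℝ (y -ℝ fromℕ k *ℝ lam)

invFactorial : ℕ → ℝ
invFactorial k = fromℚ ((+ 1 ℚ./ (k !)) {{k ℕ.!≢0}})

-- e_λ(t) = Σ (1)_{k,λ} tᵏ / k!, its real coefficients read as constant
-- polynomials in x
degenerateExp : ℝ → ℝ[x]⟦t⟧.Series
degenerateExp lam .ℝ[x]⟦t⟧.coeff k = ℝ[x].C (fallingFactorial lam 1ℝ k *ℝ invFactorial k)

fubiniDenominator : ℝ → ℝ[x]⟦t⟧.Series
fubiniDenominator lam = 1# - C ℝ[x].X * (degenerateExp lam - 1#)
  where open ℝ[x]⟦t⟧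

fubiniDenominator-constant : ∀ lam → ℝ[x]⟦t⟧.coeff (fubiniDenominator lam) 0 ℝ[x].≈ ℝ[x].1#
fubiniDenominator-constant lam = begin
  1# - (X * (e₀ - 1#) + 0#)  ≈⟨ +-congˡ (-‿cong (+-identityʳ _)) ⟩
  1# - X * (e₀ - 1#)         ≈⟨ +-congˡ (-‿cong (*-congˡ (trans (+-congʳ e₀≈1) (-‿inverseʳ 1#)))) ⟩
  1# - X * 0#                ≈⟨ +-congˡ (-‿cong (zeroʳ X)) ⟩
  1# - 0#                    ≈⟨ +-congˡ -0#≈0# ⟩
  1# + 0#                    ≈⟨ +-identityʳ 1# ⟩
  1#                         ∎
  where
  open CommutativeRing ℝ[x].commutativeRing
  open RingProperties ring using (-0#≈0#)
  open SetoidReasoning setoid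
  open ℝ[x] using (X)
  e₀ = ℝ[x]⟦t⟧.coeff (degenerateExp lam) 0
  e₀≈1 : e₀ ≈ 1#
  e₀≈1 .ℝ[x].at zero    = ≗⇒≃ λ _ → ≡.refl
  e₀≈1 .ℝ[x].at (suc _) = ≗⇒≃ λ _ → ≡.refl

fubiniGF : ℝ → ℝ[x]⟦t⟧.Series
fubiniGF lam = ℝ[x]⟦t⟧.recip (fubiniDenominator lam) (fubiniDenominator-constant lam)

-- F_{n,λ}(x) = n! [tⁿ] 1 / (1 - x (e_λ(t) - 1))
fubini : ℕ → ℝ → ℝ[x].Poly
fubini n lam = ℝ[x].C (fromℕ (n !)) ℝ[x].* ℝ[x]⟦t⟧.coeff (fubiniGF lam) n

-- Σ F_{n,λ}(x) tⁿ / n! = 1 / (1 - x (e_λ(t) - 1)), so fubini is the family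
-- determined by the generating function.
fubini-egf : ∀ lam →
  ℝ[x]⟦t⟧.series (λ n → fubini n lam ℝ[x].* ℝ[x].C (invFactorial n)) ℝ[x]⟦t⟧.≈ fubiniGF lam
fubini-egf lam .ℝ[x]⟦t⟧.at n = begin
  C (fromℕ (n !)) * g * C (invFactorial n)    ≈⟨ *-comm _ _ ⟩
  C (invFactorial n) * (C (fromℕ (n !)) * g)  ≈⟨ *-assoc _ _ _ ⟨
  C (invFactorial n) * C (fromℕ (n !)) * g    ≈⟨ *-congʳ unit ⟩
  1# * g                                      ≈⟨ *-identityˡ g ⟩
  g                                           ∎
  where
  open CommutativeRing ℝ[x].commutativeRing
  open SetoidReasoning setoid
  open ℝ[x] using (C)
  module ℝ-Ring = CommutativeRing ℝ-commutativeRing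
  g = ℝ[x]⟦t⟧.coeff (fubiniGF lam) n
  1/m*m≡1 : ∀ m .{{_ : ℕ.NonZero m}} → (+ 1 ℚ./ m) ℚ.* (+ m ℚ./ 1) ≡ 1ℚ
  1/m*m≡1 m@(suc k) = ℚ.toℚᵘ-injective (ℚᵘ.≃-trans
    (ℚ.toℚᵘ-homo-* (+ 1 ℚ./ m) (+ m ℚ./ 1))
    (ℚᵘ.≃-trans
      (ℚᵘ.*-cong (ℚ.toℚᵘ-fromℚᵘ (mkℚᵘ (+ 1) k)) (ℚ.toℚᵘ-fromℚᵘ (mkℚᵘ (+ m) 0)))
      (ℚᵘ.*-inverseˡ (mkℚᵘ (+ m) 0))))
  unit : C (invFactorial n) * C (fromℕ (n !)) ≈ 1#
  unit .ℝ[x].at k = ℝ-Ring.trans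
    (Convolution.conv-constant ℝ-commutativeRing (invFactorial n) (ℝ[x].coeff (C (fromℕ (n !)))) k)
    (step k)
    where
    step : ∀ k → invFactorial n *ℝ ℝ[x].coeff (C (fromℕ (n !))) k ≃ ℝ[x].coeff 1# k
    step zero    = ≗⇒≃ λ _ → 1/m*m≡1 (n !) {{n ℕ.!≢0}}
    step (suc _) = ≗⇒≃ λ _ → ℚ.*-zeroʳ ((+ 1 ℚ./ (n !)) {{n ℕ.!≢0}})

fubini-definingEquation : ∀ lam → let open ℝ[x]⟦t⟧ in
  fubiniDenominator lam * series (λ n → fubini n lam ℝ[x].* ℝ[x].C (invFactorial n)) ≈ 1#
fubini-definingEquation lam = trans (*-congˡ (fubini-egf lam))
  (ℝ[x]⟦t⟧.recip-inverseʳ (fubiniDenominator lam) (fubiniDenominator-constant lam))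
  where open CommutativeRing ℝ[x]⟦t⟧.commutativeRing

{-# OPTIONS --safe #-}
-- Put G = 1/(1 - x(e - 1)) with e = e_λ(t).  Applying a derivation δ to
-- (1 - x(e - 1)) G = 1 gives δG = δ(x(e - 1)) G².  For E = (1 + λt) ∂/∂t,
-- which fixes e and kills x, this is EG = x e G²; for ∂/∂x it is
-- ∂G/∂x = (e - 1) G².  Since G = (1 - x(e - 1)) G², also
-- xG + (x + x²) ∂G/∂x = x e G² = EG, and the recurrence is the coefficient
-- of tⁿ/n! in this equation.
module Submission where

open import Defs
open import Algebra.Bundles using (CommutativeRing)
open import Data.Fin.Base using (Fin; zero; suc; toℕ)
import Data.Fin.Properties as Fin
open import Data.Integer.Base as ℤ using (+_)
import Data.Integer.Properties as ℤ
open import Data.Nat.Base as ℕ using (ℕ; zero; suc; _<_; _∸_; _!)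
import Data.Nat.Properties as ℕ
open import Data.Rational.Base as ℚ using (1ℚ)
import Data.Rational.Properties as ℚ
open import Data.Rational.Unnormalised.Base as ℚᵘ using (mkℚᵘ; *≡*)
import Data.Rational.Unnormalised.Properties as ℚᵘ
open import Level using (_⊔_)
open import Relation.Binary.PropositionalEquality as ≡ using (_≡_)
open import Relation.Nullary.Negation.Core using (¬_)
import Algebra.Properties.CommutativeMonoid.Mult as CommutativeMonoidMult
import Algebra.Properties.Group as GroupProperties
import Algebra.Properties.Semiring.Mult as SemiringMult
import Algebra.Properties.Semiring.Sum as SemiringSum
import Algebra.Solver.Ring.NaturalCoefficients.Default as SemiringSolver
import Relation.Binary.Reasoning.Setoid as SetoidReasoning

-- Additive maps and derivations of a commutative ring.

module _ {c ℓ} (R : CommutativeRing c ℓ) where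

  open CommutativeRing R hiding (zero)
  open SemiringSum semiring using (sum)
  open SetoidReasoning setoid

  -- Separate from `IsDerivation` because multiplication by a fixed natural number, in general no
  -- derivation, also has to pass through convolution sums.
  record IsAdditive (δ : Carrier → Carrier) : Set (c ⊔ ℓ) where
    field
      cong   : ∀ {x y} → x ≈ y → δ x ≈ δ y
      +-homo : ∀ x y → δ (x + y) ≈ δ x + δ y

    0-homo : δ 0# ≈ 0#
    0-homo = GroupProperties.identityˡ-unique +-group (δ 0#) (δ 0#)
      (trans (sym (+-homo 0# 0#)) (cong (+-identityˡ 0#)))

    sum-homo : ∀ {n} (f : Fin n → Carrier) → δ (sum f) ≈ sum (λ i → δ (f i))
    sum-homo {zero}  f = 0-homo
    sum-homo {suc n} f = trans (+-homo (f zero) _) (+-congˡ (sum-homo (λ i → f (suc i))))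

  record IsDerivation (δ : Carrier → Carrier) : Set (c ⊔ ℓ) where
    field
      isAdditive : IsAdditive δ
      leibniz    : ∀ x y → δ (x * y) ≈ δ x * y + x * δ y

    open IsAdditive isAdditive public

    1-homo : δ 1# ≈ 0#
    1-homo = GroupProperties.identityˡ-unique +-group (δ 1#) (δ 1#) (begin
      δ 1# + δ 1#            ≈⟨ +-cong (*-identityʳ _) (*-identityˡ _) ⟨
      δ 1# * 1# + 1# * δ 1#  ≈⟨ leibniz 1# 1# ⟨
      δ (1# * 1#)            ≈⟨ cong (*-identityˡ 1#) ⟩
      δ 1#                   ∎)

-- Derivations of a reciprocal and the abstract differential equation.

module _ {c ℓ} {R : CommutativeRing c ℓ} where

  open CommutativeRing R hiding (zero)
  open SetoidReasoning setoid
  open SemiringSolver commutativeSemiring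

  _+ᵈ_·ᵈ_ : (Carrier → Carrier) → Carrier → (Carrier → Carrier) → Carrier → Carrier
  (δ +ᵈ r ·ᵈ δ′) x = δ x + r * δ′ x

  +ᵈ-isDerivation : ∀ {δ δ′} r → IsDerivation R δ → IsDerivation R δ′ → IsDerivation R (δ +ᵈ r ·ᵈ δ′)
  +ᵈ-isDerivation {δ} {δ′} r d d′ = record
    { isAdditive = record
      { cong   = λ eq → +-cong (D.cong eq) (*-congˡ (D′.cong eq))
      ; +-homo = λ x y → trans (+-cong (D.+-homo x y) (*-congˡ (D′.+-homo x y)))
          (solve 5 (λ a b r c d → (a :+ b) :+ r :* (c :+ d) := (a :+ r :* c) :+ (b :+ r :* d))
            refl (δ x) (δ y) r (δ′ x) (δ′ y))
      }
    ; leibniz = λ x y → trans (+-cong (D.leibniz x y) (*-congˡ (D′.leibniz x y)))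
        (solve 7 (λ x y a b r c d → (a :* y :+ x :* b) :+ r :* (c :* y :+ x :* d)
                                      := (a :+ r :* c) :* y :+ x :* (b :+ r :* d))
          refl x y (δ x) (δ y) r (δ′ x) (δ′ y))
    }
    where
    module D  = IsDerivation d
    module D′ = IsDerivation d′

  -- Here G = 1/(1 - y). The relation D = 1 - y is written without negation, which suits a solver
  -- for commutative semirings.
  module Reciprocal {D G y} (DG≈1 : D * G ≈ 1#) (D+y≈1 : D + y ≈ 1#) where

    derivation-recip : ∀ {δ} → IsDerivation R δ → δ G ≈ δ y * (G * G)
    derivation-recip {δ} d = begin
      δ G                ≈⟨ *-identityˡ _ ⟨
      1# * δ G           ≈⟨ *-congʳ DG≈1 ⟨
      D * G * δ G        ≈⟨ solve 3 (λ D G g → D :* G :* g := G :* (D :* g)) refl D G (δ G) ⟩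
      G * (D * δ G)      ≈⟨ *-congˡ DδG≈δyG ⟩
      G * (δ y * G)      ≈⟨ solve 2 (λ G y → G :* (y :* G) := y :* (G :* G)) refl G (δ y) ⟩
      δ y * (G * G)      ∎
      where
      open IsDerivation d
      DδG≈δyG : D * δ G ≈ δ y * G
      -- After adding `δ D * G`, both sides are 0: the left one is δ(DG) = δ1, the right one is (δD
      -- + δy) G = δ1 · G.
      DδG≈δyG = GroupProperties.∙-cancelˡ +-group (δ D * G) _ _ (begin
        δ D * G + D * δ G  ≈⟨ leibniz D G ⟨
        δ (D * G)          ≈⟨ trans (cong DG≈1) 1-homo ⟩
        0#                 ≈⟨ zeroˡ G ⟨
        0# * G             ≈⟨ *-congʳ (trans (sym 1-homo) (trans (cong (sym D+y≈1)) (+-homo D y))) ⟩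
        (δ D + δ y) * G    ≈⟨ distribʳ G (δ D) (δ y) ⟩
        δ D * G + δ y * G  ∎)

  -- The letters stand for `ξ` = x, `e` = e_λ(t), `u` = e - 1 and `D` = 1 - x(e - 1). The two
  -- derivations enter only through their values on `ξ` and `e`, since both kill the difference of
  -- `e` and `u`.
  fubini-differentialEquation : ∀ {E ∂ₓ D G ξ e u} → IsDerivation R E → IsDerivation R ∂ₓ →
    D * G ≈ 1# → D + ξ * u ≈ 1# → u + 1# ≈ e →
    E ξ ≈ 0# → E e ≈ e → ∂ₓ ξ ≈ 1# → ∂ₓ e ≈ 0# →
    E G ≈ ξ * G + (ξ * ∂ₓ G + ξ * (ξ * ∂ₓ G))
  fubini-differentialEquation {E} {∂ₓ} {D} {G} {ξ} {e} {u} dE d∂ DG≈1 D+ξu≈1 u+1≈e Eξ≈0 Ee≈e ∂ξ≈1 ∂e≈0 = begin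
    E G                                              ≈⟨ derivation-recip dE ⟩
    E (ξ * u) * (G * G)                              ≈⟨ *-congʳ Eξu≈ξe ⟩
    -- Write e = u + 1 and then 1 = D + ξu: the summand with `D` loses one factor `G` by DG = 1, and
    -- the other two contain u G², which is the x-derivative of `G`.
    ξ * e * (G * G)                                  ≈⟨ *-congʳ (*-congˡ (trans (sym u+1≈e) (+-congˡ (sym D+ξu≈1)))) ⟩
    ξ * (u + (D + ξ * u)) * (G * G)
      ≈⟨ solve 4 (λ ξ u D G → ξ :* (u :+ (D :+ ξ :* u)) :* (G :* G)
                    := ξ :* (D :* G :* G) :+ (ξ :* (u :* (G :* G)) :+ ξ :* (ξ :* (u :* (G :* G)))))
           refl ξ u D G ⟩
    ξ * (D * G * G) + (ξ * (u * (G * G)) + ξ * (ξ * (u * (G * G))))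
      ≈⟨ +-cong (*-congˡ (sym (trans (*-congʳ DG≈1) (*-identityˡ G)))) (+-cong (*-congˡ ∂G≈uGG) (*-congˡ (*-congˡ ∂G≈uGG))) ⟨
    ξ * G + (ξ * ∂ₓ G + ξ * (ξ * ∂ₓ G))              ∎
    where
    open Reciprocal DG≈1 D+ξu≈1
    module E  = IsDerivation dE
    module ∂ₓ = IsDerivation d∂
    derivation-u : ∀ {δ} → IsDerivation R δ → δ u ≈ δ e
    derivation-u {δ} d = begin
      δ u          ≈⟨ +-identityʳ _ ⟨
      δ u + 0#     ≈⟨ +-congˡ 1-homo ⟨
      δ u + δ 1#   ≈⟨ +-homo u 1# ⟨
      δ (u + 1#)   ≈⟨ cong u+1≈e ⟩
      δ e          ∎
      where open IsDerivation d
    Eξu≈ξe : E (ξ * u) ≈ ξ * e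
    Eξu≈ξe = begin
      E (ξ * u)          ≈⟨ E.leibniz ξ u ⟩
      E ξ * u + ξ * E u  ≈⟨ +-cong (trans (*-congʳ Eξ≈0) (zeroˡ u)) (*-congˡ (trans (derivation-u dE) Ee≈e)) ⟩
      0# + ξ * e         ≈⟨ +-identityˡ _ ⟩
      ξ * e              ∎
    ∂G≈uGG : ∂ₓ G ≈ u * (G * G)
    ∂G≈uGG = begin
      ∂ₓ G                           ≈⟨ derivation-recip d∂ ⟩
      ∂ₓ (ξ * u) * (G * G)           ≈⟨ *-congʳ (∂ₓ.leibniz ξ u) ⟩
      (∂ₓ ξ * u + ξ * ∂ₓ u) * (G * G) ≈⟨ *-congʳ (+-cong (trans (*-congʳ ∂ξ≈1) (*-identityˡ u))
                                          (trans (*-congˡ (trans (derivation-u d∂) ∂e≈0)) (zeroʳ ξ))) ⟩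
      (u + 0#) * (G * G)             ≈⟨ *-congʳ (+-identityʳ u) ⟩
      u * (G * G)                    ∎

  -- Used with `f` = n!, `a` = (n+1) g_{n+1}, `b` = nλ, `g` = g_n and `d` = g_n', where g_n is the
  -- coefficient of t^n in G. The term with `b` changes sides by cancellation.
  scaled-recurrence : ∀ f {a b g x d} → a + b * g ≈ x * g + (x * d + x * (x * d)) →
    f * a ≈ (x + (- b)) * (f * g) + (x + x * x) * (f * d)
  scaled-recurrence f {a} {b} {g} {x} {d} eq =
    GroupProperties.∙-cancelʳ +-group (b * (f * g)) _ _ (begin
      f * a + b * (f * g)
        ≈⟨ solve 4 (λ f a b g → f :* a :+ b :* (f :* g) := f :* (a :+ b :* g)) refl f a b g ⟩
      f * (a + b * g)
        ≈⟨ *-congˡ eq ⟩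
      f * (x * g + (x * d + x * (x * d)))
        -- The summand `con 0` makes room for `- b + b` in the next step.
        ≈⟨ solve 4 (λ f g x d → f :* (x :* g :+ (x :* d :+ x :* (x :* d)))
                                  := (x :+ con 0) :* (f :* g) :+ (x :+ x :* x) :* (f :* d))
             refl f g x d ⟩
      (x + 0#) * (f * g) + (x + x * x) * (f * d)
        ≈⟨ +-congʳ (*-congʳ (+-congˡ (-‿inverseˡ b))) ⟨
      (x + (- b + b)) * (f * g) + (x + x * x) * (f * d)
        ≈⟨ solve 6 (λ f g x d b′ b → (x :+ (b′ :+ b)) :* (f :* g) :+ (x :+ x :* x) :* (f :* d)
                      := ((x :+ b′) :* (f :* g) :+ (x :+ x :* x) :* (f :* d)) :+ b :* (f :* g))
             refl f g x d (- b) b ⟩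
      (x + (- b)) * (f * g) + (x + x * x) * (f * d) + b * (f * g) ∎)

-- Leibniz rules for convolutions of coefficient sequences.

module ConvolutionDerivations {c ℓ} (R : CommutativeRing c ℓ) where

  open CommutativeRing R hiding (zero)
  open Convolution R
  open SemiringMult semiring using (_×_; ×-congʳ; ×-homo-+; ×-assoc-*; ×-comm-*)
  open CommutativeMonoidMult +-commutativeMonoid using (×-distrib-+)
  open SemiringSum semiring using (sum-cong-≋; ∑-distrib-+)
  open SetoidReasoning setoid

  ×-isAdditive : ∀ n → IsAdditive R (n ×_)
  ×-isAdditive n = record { cong = ×-congʳ n ; +-homo = λ x y → ×-distrib-+ x y n }

  -- The operator t d/dt on coefficients.
  euler : (ℕ → Carrier) → ℕ → Carrier
  euler a k = k × a k

  derivative : (ℕ → Carrier) → ℕ → Carrier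
  derivative a k = suc k × a (suc k)

  -- The weight `n` splits as `i + (n ∸ i)`, one share for each factor; `i ≤ n` makes the truncated
  -- subtraction exact.
  ×-leibniz : ∀ {n} i → i ℕ.≤ n → ∀ x y → n × (x * y) ≈ (i × x) * y + x * ((n ∸ i) × y)
  ×-leibniz {n} i i≤n x y = begin
    n × (x * y)                          ≡⟨ ≡.cong (_× (x * y)) (ℕ.m+[n∸m]≡n i≤n) ⟨
    (i ℕ.+ (n ∸ i)) × (x * y)            ≈⟨ ×-homo-+ (x * y) i (n ∸ i) ⟩
    i × (x * y) + (n ∸ i) × (x * y)      ≈⟨ +-cong (×-assoc-* i x y) (×-comm-* (n ∸ i) x y) ⟨
    (i × x) * y + x * ((n ∸ i) × y)      ∎

  euler-leibniz : ∀ a b n → euler (conv a b) n ≈ conv (euler a) b n + conv a (euler b) n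
  euler-leibniz a b n = begin
    n × conv a b n
      ≈⟨ IsAdditive.sum-homo (×-isAdditive n) {suc n} (λ i → a (toℕ i) * b (n ∸ toℕ i)) ⟩
    _
      ≈⟨ sum-cong-≋ {n = suc n} (λ i → ×-leibniz (toℕ i) (Fin.toℕ≤pred[n] i) (a (toℕ i)) (b (n ∸ toℕ i))) ⟩
    _
      ≈⟨ ∑-distrib-+ {suc n} (λ i → euler a (toℕ i) * b (n ∸ toℕ i)) (λ i → a (toℕ i) * euler b (n ∸ toℕ i)) ⟩
    conv (euler a) b n + conv a (euler b) n ∎

  -- `derivative` is `euler` shifted by one index, so this is the rule for `euler` at `suc n`.
  derivative-leibniz : ∀ a b n → derivative (conv a b) n ≈ conv (derivative a) b n + conv a (derivative b) n
  derivative-leibniz a b n = begin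
    euler (conv a b) (suc n)
      ≈⟨ euler-leibniz a b (suc n) ⟩
    (0# * b (suc n) + conv (derivative a) b n) + conv a (euler b) (suc n)
      -- The shift drops the terms with `euler a 0` and `euler b 0`, both of weight 0. The second is
      -- the last term of its convolution, hence `conv-last`.
      ≈⟨ +-cong (trans (+-congʳ (zeroˡ _)) (+-identityˡ _))
           (trans (conv-last a (euler b) n) (trans (+-congʳ (zeroʳ _)) (+-identityˡ _))) ⟩
    conv (derivative a) b n + conv a (derivative b) n ∎

-- Derivations of polynomials and of power series.

module _ {c ℓ} (R : CommutativeRing c ℓ) where

  private module R = CommutativeRing R
  open ConvolutionDerivations R
  open SemiringMult R.semiring using () renaming (_×_ to _R×_)

  module PolynomialDerivation where
    open Polynomial R
    open SemiringMult (CommutativeRing.semiring commutativeRing) using () renaming (_×_ to _P×_)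

    ∂-isDerivation : IsDerivation commutativeRing ∂
    ∂-isDerivation = record
      { isAdditive = record
        { cong   = λ p≈q → mk≈ λ k → IsAdditive.cong (×-isAdditive (suc k)) (at p≈q (suc k))
        ; +-homo = λ p q → mk≈ λ k → IsAdditive.+-homo (×-isAdditive (suc k)) _ _
        }
      ; leibniz = λ p q → mk≈ (derivative-leibniz (coeff p) (coeff q))
      }

    ∂C≈0 : ∀ r → ∂ (C r) ≈ 0#
    ∂C≈0 r .at k = IsAdditive.0-homo (×-isAdditive (suc k))

    ∂X≈1 : ∂ X ≈ 1#
    ∂X≈1 .at zero    = R.+-identityʳ R.1#
    ∂X≈1 .at (suc k) = IsAdditive.0-homo (×-isAdditive (suc (suc k)))

    ∂-C-* : ∀ r p → ∂ (C r * p) ≈ C r * ∂ p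
    ∂-C-* r p = begin
      ∂ (C r * p)              ≈⟨ leibniz (C r) p ⟩
      ∂ (C r) * p + C r * ∂ p  ≈⟨ P.+-congʳ (P.trans (P.*-congʳ (∂C≈0 r)) (P.zeroˡ p)) ⟩
      0# + C r * ∂ p           ≈⟨ P.+-identityˡ _ ⟩
      C r * ∂ p                ∎
      where
      module P = CommutativeRing commutativeRing
      open IsDerivation ∂-isDerivation
      open SetoidReasoning P.setoid

    C-cong : ∀ {r s} → r R.≈ s → C r ≈ C s
    C-cong r≈s .at zero    = r≈s
    C-cong r≈s .at (suc k) = R.refl

    C-+ : ∀ r s → C (r R.+ s) ≈ C r + C s
    C-+ r s .at zero    = R.refl
    C-+ r s .at (suc k) = R.sym (R.+-identityʳ R.0#)

    C-* : ∀ r s → C (r R.* s) ≈ C r * C s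
    C-* r s .at k = R.trans (scaled k) (R.sym (conv-constant r (constant s) k))
      where
      open Convolution R
      scaled : ∀ k → constant (r R.* s) k R.≈ r R.* constant s k
      scaled zero    = R.refl
      scaled (suc k) = R.sym (R.zeroʳ r)

    C-× : ∀ n r → C (n R× r) ≈ n P× C r
    C-× zero    r = mk≈ λ { zero → R.refl ; (suc k) → R.refl }
    C-× (suc n) r = P.trans (C-+ r (n R× r)) (P.+-congˡ (C-× n r))
      where module P = CommutativeRing commutativeRing

  module SeriesDerivations where
    open CommutativeRing R using (Carrier)
    open PowerSeries R
    open SemiringSum (CommutativeRing.semiring R) using (sum-cong-≋; ∑-distrib-+)

    ∂ₜ θ : Series → Series
    ∂ₜ f .coeff = derivative (coeff f)
    θ f .coeff  = euler (coeff f)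

    ∂ₜ-isDerivation : IsDerivation commutativeRing ∂ₜ
    ∂ₜ-isDerivation = record
      { isAdditive = record
        { cong   = λ f≈g → mk≈ λ k → IsAdditive.cong (×-isAdditive (suc k)) (at f≈g (suc k))
        ; +-homo = λ f g → mk≈ λ k → IsAdditive.+-homo (×-isAdditive (suc k)) _ _
        }
      ; leibniz = λ f g → mk≈ (derivative-leibniz (coeff f) (coeff g))
      }

    θ-isDerivation : IsDerivation commutativeRing θ
    θ-isDerivation = record
      { isAdditive = record
        { cong   = λ f≈g → mk≈ λ k → IsAdditive.cong (×-isAdditive k) (at f≈g k)
        ; +-homo = λ f g → mk≈ λ k → IsAdditive.+-homo (×-isAdditive k) _ _
        }
      ; leibniz = λ f g → mk≈ (euler-leibniz (coeff f) (coeff g))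
      }

    coefficientwise : (Carrier → Carrier) → Series → Series
    coefficientwise δ f .coeff n = δ (coeff f n)

    coefficientwise-isDerivation : ∀ {δ} → IsDerivation R δ → IsDerivation commutativeRing (coefficientwise δ)
    coefficientwise-isDerivation {δ} d = record
      { isAdditive = record
        { cong   = λ f≈g → mk≈ λ n → cong (at f≈g n)
        ; +-homo = λ f g → mk≈ λ n → +-homo (coeff f n) (coeff g n)
        }
      ; leibniz = λ f g → mk≈ λ n → let a = coeff f ; b = coeff g in
          R.trans (sum-homo {suc n} (λ i → a (toℕ i) R.* b (n ∸ toℕ i)))
            (R.trans (sum-cong-≋ {n = suc n} (λ i → leibniz (a (toℕ i)) (b (n ∸ toℕ i))))
              (∑-distrib-+ {suc n} (λ i → δ (a (toℕ i)) R.* b (n ∸ toℕ i)) (λ i → a (toℕ i) R.* δ (b (n ∸ toℕ i)))))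
      }
      where
      open IsDerivation d

    ∂ₜC≈0 : ∀ r → ∂ₜ (C r) ≈ 0#
    ∂ₜC≈0 r .at k = IsAdditive.0-homo (×-isAdditive (suc k))

    θC≈0 : ∀ r → θ (C r) ≈ 0#
    θC≈0 r .at zero    = R.refl
    θC≈0 r .at (suc k) = IsAdditive.0-homo (×-isAdditive (suc k))

-- Real numerals, factorials and the coefficients of the degenerate exponential.

module ℝ-Ring = CommutativeRing ℝ-commutativeRing
module P = CommutativeRing ℝ[x].commutativeRing
module S = CommutativeRing ℝ[x]⟦t⟧.commutativeRing
open SemiringMult ℝ-Ring.semiring using (×-assoc-*; ×-comm-*; ×1-homo-*) renaming (_×_ to _·_)
open SemiringMult P.semiring using () renaming (_×_ to _∙_; ×-assoc-* to ∙-assoc-*; ×-comm-* to ∙-comm-*)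
open PolynomialDerivation ℝ-commutativeRing
open SeriesDerivations ℝ[x].commutativeRing

-- The fraction `+ n ℚ./ 1` is reduced by a gcd that does not compute for a variable `n`; among
-- unnormalised rationals the claim is an identity of integers.
fromℕ-suc : ∀ n → fromℕ (suc n) ≃ 1ℝ +ℝ fromℕ n
fromℕ-suc n = ≗⇒≃ λ _ → ℚ.toℚᵘ-injective (begin
  ℚ.toℚᵘ (+ suc n ℚ./ 1)                  ≈⟨ ℚ.toℚᵘ-fromℚᵘ (mkℚᵘ (+ suc n) 0) ⟩
  mkℚᵘ (+ suc n) 0                        ≈⟨ *≡* (≡.cong (ℤ._* + 1) (≡.cong (ℤ._+_ (+ 1)) (≡.sym (ℤ.*-identityʳ (+ n))))) ⟩
  mkℚᵘ (+ 1) 0 ℚᵘ.+ mkℚᵘ (+ n) 0          ≈⟨ ℚᵘ.+-cong ℚᵘ.≃-refl (ℚ.toℚᵘ-fromℚᵘ (mkℚᵘ (+ n) 0)) ⟨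
  ℚ.toℚᵘ 1ℚ ℚᵘ.+ ℚ.toℚᵘ (+ n ℚ./ 1)       ≈⟨ ℚ.toℚᵘ-homo-+ 1ℚ (+ n ℚ./ 1) ⟨
  ℚ.toℚᵘ (1ℚ ℚ.+ (+ n ℚ./ 1))             ∎)
  where open SetoidReasoning ℚᵘ.≃-setoid

fromℕ≃·1 : ∀ n → fromℕ n ≃ n · 1ℝ
fromℕ≃·1 zero    = ℝ-Ring.refl
fromℕ≃·1 (suc n) = ℝ-Ring.trans (fromℕ-suc n) (ℝ-Ring.+-congˡ (fromℕ≃·1 n))

fromℕ-*≃· : ∀ n r → fromℕ n *ℝ r ≃ n · r
fromℕ-*≃· n r = begin
  fromℕ n *ℝ r     ≈⟨ ℝ-Ring.*-congʳ (fromℕ≃·1 n) ⟩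
  (n · 1ℝ) *ℝ r    ≈⟨ ×-assoc-* n 1ℝ r ⟩
  n · (1ℝ *ℝ r)    ≈⟨ IsAdditive.cong (ConvolutionDerivations.×-isAdditive ℝ-commutativeRing n) (ℝ-Ring.*-identityˡ r) ⟩
  n · r            ∎
  where open SetoidReasoning ℝ-Ring.setoid

fromℕ-* : ∀ m n → fromℕ (m ℕ.* n) ≃ fromℕ m *ℝ fromℕ n
fromℕ-* m n = begin
  fromℕ (m ℕ.* n)          ≈⟨ fromℕ≃·1 (m ℕ.* n) ⟩
  (m ℕ.* n) · 1ℝ           ≈⟨ ×1-homo-* m n ⟩
  (m · 1ℝ) *ℝ (n · 1ℝ)     ≈⟨ ℝ-Ring.*-cong (fromℕ≃·1 m) (fromℕ≃·1 n) ⟨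
  fromℕ m *ℝ fromℕ n       ∎
  where open SetoidReasoning ℝ-Ring.setoid

m*1/[m*n]≡1/n : ∀ m n .{{_ : ℕ.NonZero m}} .{{_ : ℕ.NonZero n}} .{{_ : ℕ.NonZero (m ℕ.* n)}} →
  (+ m ℚ./ 1) ℚ.* (+ 1 ℚ./ (m ℕ.* n)) ≡ + 1 ℚ./ n
m*1/[m*n]≡1/n m@(suc m-1) n@(suc n-1) = ℚ.toℚᵘ-injective (begin
  ℚ.toℚᵘ ((+ m ℚ./ 1) ℚ.* (+ 1 ℚ./ (m ℕ.* n)))
    ≈⟨ ℚ.toℚᵘ-homo-* (+ m ℚ./ 1) (+ 1 ℚ./ (m ℕ.* n)) ⟩
  ℚ.toℚᵘ (+ m ℚ./ 1) ℚᵘ.* ℚ.toℚᵘ (+ 1 ℚ./ (m ℕ.* n))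
    -- `mkℚᵘ` stores the denominator minus one, and `n-1 ℕ.+ m-1 ℕ.* n` is the predecessor of
    -- `m ℕ.* n`.
    ≈⟨ ℚᵘ.*-cong (ℚ.toℚᵘ-fromℚᵘ (mkℚᵘ (+ m) 0)) (ℚ.toℚᵘ-fromℚᵘ (mkℚᵘ (+ 1) (n-1 ℕ.+ m-1 ℕ.* n))) ⟩
  mkℚᵘ (+ m) 0 ℚᵘ.* mkℚᵘ (+ 1) (n-1 ℕ.+ m-1 ℕ.* n)
    ≈⟨ *≡* (≡.cong +_ (≡.trans (≡.cong (ℕ._* n) (ℕ.*-identityʳ m)) (≡.sym (≡.trans (ℕ.*-identityˡ _) (ℕ.*-identityˡ (m ℕ.* n)))))) ⟩
  mkℚᵘ (+ 1) n-1
    ≈⟨ ℚ.toℚᵘ-fromℚᵘ (mkℚᵘ (+ 1) n-1) ⟨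
  ℚ.toℚᵘ (+ 1 ℚ./ n) ∎)
  where open SetoidReasoning ℚᵘ.≃-setoid

suc·invFactorial-suc : ∀ k → suc k · invFactorial (suc k) ≃ invFactorial k
suc·invFactorial-suc k = ℝ-Ring.trans (ℝ-Ring.sym (fromℕ-*≃· (suc k) (invFactorial (suc k))))
  (≗⇒≃ λ _ → m*1/[m*n]≡1/n (suc k) (k !) {{_}} {{k ℕ.!≢0}} {{suc k ℕ.!≢0}})

-- The coefficient form of (1 + λt) e' = e. The factor 1 - kλ that leads from (1)_{k,λ} to
-- (1)_{k+1,λ} contributes -kλ, and the second summand cancels it.
fallingFactorial-recurrence : ∀ lam k → let a = λ k → fallingFactorial lam 1ℝ k *ℝ invFactorial k in
  suc k · a (suc k) +ℝ lam *ℝ (k · a k) ≃ a k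
fallingFactorial-recurrence lam k = begin
  suc k · (f *ℝ (1ℝ +ℝ -ℝ (n *ℝ lam)) *ℝ invFactorial (suc k)) +ℝ lam *ℝ (k · (f *ℝ i))
    ≈⟨ ℝ-Ring.+-cong (×-comm-* (suc k) _ _) (ℝ-Ring.*-congˡ (fromℕ-*≃· k (f *ℝ i))) ⟨
  f *ℝ (1ℝ +ℝ -ℝ (n *ℝ lam)) *ℝ (suc k · invFactorial (suc k)) +ℝ lam *ℝ (n *ℝ (f *ℝ i))
    ≈⟨ ℝ-Ring.+-congʳ (ℝ-Ring.*-congˡ (suc·invFactorial-suc k)) ⟩
  f *ℝ (1ℝ +ℝ -ℝ (n *ℝ lam)) *ℝ i +ℝ lam *ℝ (n *ℝ (f *ℝ i))
    -- The negated product is passed as an opaque variable `m`, so that it ends up next to `n :* l`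
    -- and cancels in the following step.
    ≈⟨ solve 6 (λ f o m i l n → f :* (o :+ m) :* i :+ l :* (n :* (f :* i)) := f :* (o :+ (m :+ n :* l)) :* i)
         ℝ-Ring.refl f 1ℝ (-ℝ (n *ℝ lam)) i lam n ⟩
  f *ℝ (1ℝ +ℝ (-ℝ (n *ℝ lam) +ℝ n *ℝ lam)) *ℝ i
    ≈⟨ ℝ-Ring.*-congʳ (ℝ-Ring.*-congˡ (ℝ-Ring.trans (ℝ-Ring.+-congˡ (ℝ-Ring.-‿inverseˡ (n *ℝ lam))) (ℝ-Ring.+-identityʳ 1ℝ))) ⟩
  f *ℝ 1ℝ *ℝ i
    ≈⟨ ℝ-Ring.*-congʳ (ℝ-Ring.*-identityʳ f) ⟩
  f *ℝ i ∎
  where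
  open SetoidReasoning ℝ-Ring.setoid
  open SemiringSolver ℝ-Ring.commutativeSemiring
  f = fallingFactorial lam 1ℝ k
  i = invFactorial k
  n = fromℕ k

-- The differential equation of the generating function and its coefficients.

module _ (lam : ℝ) where

  open ℝ[x] using (C; X)
  open ℝ[x]⟦t⟧ using (Series; coeff; at) renaming (C to Cₜ)
  open Convolution ℝ[x].commutativeRing using (conv-constant)

  -- `E` is (1 + λt) ∂/∂t. With t ∂/∂t taken as the derivation `θ`, the remaining multiplier λ is a
  -- constant series, and multiplying by it acts on each coefficient separately.
  E ∂ₓ : Series → Series
  E  = _+ᵈ_·ᵈ_ {R = ℝ[x]⟦t⟧.commutativeRing} ∂ₜ (Cₜ (C lam)) θ
  ∂ₓ = coefficientwise ℝ[x].∂

  E-coeff : ∀ f n → coeff (E f) n P.≈ suc n ∙ coeff f (suc n) P.+ C lam P.* (n ∙ coeff f n)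
  E-coeff f n = P.+-congˡ (conv-constant (C lam) (coeff (θ f)) n)

  E-constant : ∀ p → E (Cₜ p) S.≈ S.0#
  E-constant p = S.trans
    (S.+-cong (∂ₜC≈0 p) (S.trans (S.*-congˡ (θC≈0 p)) (S.zeroʳ (Cₜ (C lam)))))
    (S.+-identityʳ S.0#)

  -- All coefficients are constant polynomials, so the real recurrence is carried over by `C`, which
  -- respects sums, products and natural multiples.
  E-degenerateExp : E (degenerateExp lam) S.≈ degenerateExp lam
  E-degenerateExp .at n = begin
    coeff (E (degenerateExp lam)) n                ≈⟨ E-coeff (degenerateExp lam) n ⟩
    suc n ∙ C (a (suc n)) P.+ C lam P.* (n ∙ C (a n))
      ≈⟨ P.+-cong (C-× (suc n) (a (suc n))) (P.trans (C-* lam (n · a n)) (P.*-congˡ (C-× n (a n)))) ⟨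
    C (suc n · a (suc n)) P.+ C (lam *ℝ (n · a n))  ≈⟨ C-+ _ _ ⟨
    C (suc n · a (suc n) +ℝ lam *ℝ (n · a n))       ≈⟨ C-cong (fallingFactorial-recurrence lam n) ⟩
    C (a n)                                         ∎
    where
    open SetoidReasoning P.setoid
    a : ℕ → ℝ
    a k = fallingFactorial lam 1ℝ k *ℝ invFactorial k

  ∂ₓ-X : ∂ₓ (Cₜ X) S.≈ S.1#
  ∂ₓ-X .at zero    = ∂X≈1
  ∂ₓ-X .at (suc n) = IsDerivation.0-homo ∂-isDerivation

  ∂ₓ-degenerateExp : ∂ₓ (degenerateExp lam) S.≈ S.0#
  ∂ₓ-degenerateExp .at n = ∂C≈0 _

  -- Turns the differences 1 - x(e - 1) and e - 1 into the negation-free hypotheses of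
  -- `fubini-differentialEquation`.
  subtract-add : ∀ f g → (f S.+ (S.- g)) S.+ g S.≈ f
  subtract-add f g = GroupProperties.//-rightDividesˡ S.+-group g f

  fubiniGF-equation : E (fubiniGF lam) S.≈
    Cₜ X S.* fubiniGF lam S.+ (Cₜ X S.* ∂ₓ (fubiniGF lam) S.+ Cₜ X S.* (Cₜ X S.* ∂ₓ (fubiniGF lam)))
  fubiniGF-equation = fubini-differentialEquation
    {R = ℝ[x]⟦t⟧.commutativeRing} {u = degenerateExp lam S.+ (S.- S.1#)}
    (+ᵈ-isDerivation (Cₜ (C lam)) ∂ₜ-isDerivation θ-isDerivation)
    (coefficientwise-isDerivation ∂-isDerivation)
    (ℝ[x]⟦t⟧.recip-inverseʳ (fubiniDenominator lam) (fubiniDenominator-constant lam))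
    (subtract-add S.1# (Cₜ X S.* (degenerateExp lam S.+ (S.- S.1#))))
    (subtract-add (degenerateExp lam) S.1#)
    (E-constant X) E-degenerateExp ∂ₓ-X ∂ₓ-degenerateExp

  -- Compares coefficients of t^n in `fubiniGF-equation`; x is constant in t, so each product with
  -- `Cₜ X` is taken coefficientwise.
  fubiniGF-recurrence : ∀ n → let g = coeff (fubiniGF lam) in
    suc n ∙ g (suc n) P.+ C (fromℕ n *ℝ lam) P.* g n P.≈
    X P.* g n P.+ (X P.* ℝ[x].∂ (g n) P.+ X P.* (X P.* ℝ[x].∂ (g n)))
  fubiniGF-recurrence n = begin
    suc n ∙ g (suc n) P.+ C (fromℕ n *ℝ lam) P.* g n   ≈⟨ P.+-congˡ scalar ⟩
    suc n ∙ g (suc n) P.+ C lam P.* (n ∙ g n)          ≈⟨ E-coeff (fubiniGF lam) n ⟨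
    coeff (E (fubiniGF lam)) n                         ≈⟨ at fubiniGF-equation n ⟩
    coeff (Cₜ X S.* fubiniGF lam S.+ (Cₜ X S.* ∂ₓ (fubiniGF lam) S.+ Cₜ X S.* (Cₜ X S.* ∂ₓ (fubiniGF lam)))) n
      ≈⟨ P.+-cong (conv-constant X g n) (P.+-cong (conv-constant X (coeff (∂ₓ (fubiniGF lam))) n)
           (P.trans (conv-constant X (coeff (Cₜ X S.* ∂ₓ (fubiniGF lam))) n)
             (P.*-congˡ (conv-constant X (coeff (∂ₓ (fubiniGF lam))) n)))) ⟩
    X P.* g n P.+ (X P.* ℝ[x].∂ (g n) P.+ X P.* (X P.* ℝ[x].∂ (g n))) ∎
    where
    open SetoidReasoning P.setoid
    g = coeff (fubiniGF lam)
    scalar : C (fromℕ n *ℝ lam) P.* g n P.≈ C lam P.* (n ∙ g n)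
    scalar = begin
      C (fromℕ n *ℝ lam) P.* g n   ≈⟨ P.*-congʳ (C-cong (fromℕ-*≃· n lam)) ⟩
      C (n · lam) P.* g n          ≈⟨ P.*-congʳ (C-× n lam) ⟩
      (n ∙ C lam) P.* g n          ≈⟨ ∙-assoc-* n (C lam) (g n) ⟩
      n ∙ (C lam P.* g n)          ≈⟨ ∙-comm-* n (C lam) (g n) ⟨
      C lam P.* (n ∙ g n)          ∎

  -- F_{n+1} carries the factor (n+1)!, while the recurrence for G supplies (n+1) g_{n+1}. Splitting
  -- (n+1)! as (n+1) n! leaves n! as the common factor.
  C-suc! : ∀ n p → C (fromℕ (suc n !)) P.* p P.≈ C (fromℕ (n !)) P.* (suc n ∙ p)
  C-suc! n p = begin
    C (fromℕ (suc n !)) P.* p            ≈⟨ P.*-congʳ (C-cong (ℝ-Ring.trans (fromℕ-* (suc n) (n !)) (fromℕ-*≃· (suc n) _))) ⟩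
    C (suc n · fromℕ (n !)) P.* p        ≈⟨ P.*-congʳ (C-× (suc n) (fromℕ (n !))) ⟩
    (suc n ∙ C (fromℕ (n !))) P.* p      ≈⟨ ∙-assoc-* (suc n) (C (fromℕ (n !))) p ⟩
    suc n ∙ (C (fromℕ (n !)) P.* p)      ≈⟨ ∙-comm-* (suc n) (C (fromℕ (n !))) p ⟨
    C (fromℕ (n !)) P.* (suc n ∙ p)      ∎
    where open SetoidReasoning P.setoid

theorem14 : (lam : ℝ) → ¬ (lam ≃ 0ℝ) → (n : ℕ) → 0 < n →
    let open ℝ[x] in
    fubini (suc n) lam ≈ (X - C (fromℕ n *ℝ lam)) * fubini n lam + (X + X * X) * ∂ (fubini n lam)
theorem14 lam _ n _ = begin
  fubini (suc n) lam
    ≈⟨ C-suc! lam n (g (suc n)) ⟩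
  C (fromℕ (n !)) * (suc n ∙ g (suc n))
    ≈⟨ scaled-recurrence {R = commutativeRing} (C (fromℕ (n !))) (fubiniGF-recurrence lam n) ⟩
  (X - C (fromℕ n *ℝ lam)) * fubini n lam + (X + X * X) * (C (fromℕ (n !)) * ∂ (g n))
    -- The constant n! moves inside the derivative, where n! g_n is `fubini n lam` by definition.
    ≈⟨ P.+-congˡ (P.*-congˡ (∂-C-* (fromℕ (n !)) (g n))) ⟨
  (X - C (fromℕ n *ℝ lam)) * fubini n lam + (X + X * X) * ∂ (fubini n lam) ∎
  where
  open ℝ[x] using (C; X; ∂; _+_; _*_; _-_; commutativeRing)
  open SetoidReasoning P.setoid
  g = ℝ[x]⟦t⟧.coeff (fubiniGF lam)
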